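{- For every positive integer $k$ there exists $\epsilon>0$ such that for every sufficiently large integer $n$ there exists a digraph $D$ on $n$ vertices with the following two properties: - $\chi(D)>k$; - $\chi(D[S])\le 2$ for every $S\subseteq V(D)$ with $|S|\le\epsilon n$.
   Context: Digraphs are loopless. A set $A\subseteq V(D)$ is acyclic if the induced subdigraph $D[A]$ contains no directed cycle. The chromatic number $\chi(D)$ of a digraph $D$ is the minimum integer $k$ such that $V(D)$ can be partitioned into at most $k$ acyclic sets. $D[S]$ denotes the subdigraph induced by $S$. -}

module Defs where

open import Data.Nat using (ℕ; zero; suc)
open import Data.Bool using (Bool; true; false)
open import Data.Fin using (Fin; zero; suc; inject₁; fromℕ)
open import Data.Fin.Subset using (Subset; _∈_)
open import Data.Product using (Σ; _×_; ∃)
open import Data.Integer using (+_)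
open import Data.Rational using (ℚ; _/_)
open import Function.Definitions using (Injective)
open import Relation.Binary.PropositionalEquality using (_≡_)
open import Relation.Nullary using (¬_)

record Digraph (n : ℕ) : Set where
  field
    adj      : Fin n → Fin n → Bool
    loopless : ∀ v → adj v v ≡ false
open Digraph public

Arc : ∀ {n} → Digraph n → Fin n → Fin n → Set
Arc D u v = adj D u v ≡ true

record CycleIn {n : ℕ} (D : Digraph n) (A : Fin n → Set) : Set where
  field
    m       : ℕ
    f       : Fin (suc (suc m)) → Fin n
    f-inj   : Injective _≡_ _≡_ f
    inA     : ∀ i → A (f i)
    arcs    : ∀ (i : Fin (suc m)) → Arc D (f (inject₁ i)) (f (suc i))
    closing : Arc D (f (fromℕ (suc m))) (f zero)

Acyclic : ∀ {n} → Digraph n → (Fin n → Set) → Set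
Acyclic D A = ¬ CycleIn D A

-- χ(D[S]) ≤ k : S can be partitioned into at most k acyclic sets
-- (colour classes of a map c into Fin k; empty classes allowed).
ChromaticAtMost : ∀ {n} → Digraph n → Subset n → ℕ → Set
ChromaticAtMost {n} D S k =
  Σ (Fin n → Fin k) λ c → ∀ (j : Fin k) → Acyclic D (λ v → (v ∈ S) × (c v ≡ j))

toℚ : ℕ → ℚ
toℚ n = + n / 1

{-# OPTIONS --safe #-}

-- A random digraph with bounded out-degree works.  Let every vertex choose d
-- out-neighbours at random.
--
-- Lower bound: an acyclic set of size a, with its sinks removed one after the
-- other, splits into halves X and Y with no arc from X to Y.  Some colour class
-- of a k-colouring has size at least n/k, so it suffices that for any two sets
-- X, Y of size at least n/(3k) some vertex of X chooses a vertex of Y; for large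
-- d this survives a union bound over the 4^n pairs.
--
-- Upper bound: if every nonempty subset of S contains a vertex with at most one
-- out-neighbour in that subset, then S is 2-colourable greedily.  A set T of
-- size s where every vertex has two out-neighbours in T has weight at least
-- r^(2s), where each chosen arc inside T counts with a factor r ≈ n/s.  The
-- expected weight is at most 2^(ds) and there are at most (16 r)^s such T, so
-- the expected number of bad T is at most (16 * 2^d / r)^s ≤ 4^(-s) when s ≤ ε n.
--
-- Probabilities are replaced by counting over all choices, with the
-- denominators cleared.

module Submission where

open import Defs
open import Data.Bool using (true; false; if_then_else_) renaming (_≟_ to _≟ᵇ_)
open import Data.Fin using (Fin; zero; suc; toℕ; _<?_)
open import Data.Fin.Properties using (any?; pigeonhole; toℕ-inject₁; toℕ-fromℕ; toℕ<n; <-cmp) renaming (_≟_ to _≟ᶠ_)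
open import Data.Fin.Relation.Unary.Top using (view; ‵fromℕ; ‵inject₁)
open import Data.Fin.Subset using (Subset; ⊤; ⊥; ∣_∣; _∈_; _∉_; _⊆_; _-_; _∪_; ⁅_⁆; Nonempty)
open import Data.Fin.Subset.Properties
open import Data.Integer as ℤ using ()
import Data.Integer.Properties as ℤ
open import Data.List using (List; []; _∷_; _++_; map; length; cartesianProductWith; allFin; downFrom) renaming (tabulate to tabulateˡ)
open import Data.List.Membership.Propositional using () renaming (_∈_ to _∈ˡ_)
open import Data.List.Membership.Propositional.Properties using (∈-cartesianProductWith⁺; ∈-downFrom⁺; ∈-allFin)
open import Data.List.Properties using (length-tabulate)
open import Data.List.Relation.Unary.Any using (here; there)
open import Data.Nat using (ℕ; zero; suc; _+_; _*_; _∸_; _^_; _/_; _%_; ⌊_/2⌋; _≤_; _<_; _≥_; z≤n; s≤s; _≤?_; _≟_; NonZero; >-nonZero; >-nonZero⁻¹)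
open import Data.Nat.DivMod using (m/n*n≤m; m≡m%n+[m/n]*n; m%n<n; m*n/n≡m; /-monoˡ-≤)
open import Data.Nat.Properties hiding (_≤?_; _≟_; _<?_; <-cmp)
open import Data.Nat.Tactic.RingSolver using (solve-∀)
open import Data.Product using (Σ; ∃; _×_; _,_; proj₁; proj₂)
open import Data.Rational as ℚ using (ℚ; Positive)
import Data.Rational.Properties as ℚ
open import Data.Rational.Unnormalised as ℚᵘ using (mkℚᵘ)
import Data.Rational.Unnormalised.Properties as ℚᵘ
open import Data.Sum using (inj₁; inj₂)
open import Data.Vec using (Vec; []; _∷_; here; there; lookup; tabulate)
open import Data.Vec.Properties using ([]=⇒lookup; lookup⇒[]=; lookup∘tabulate)
open import Function using (_∘_; id)
open import Relation.Binary.Definitions using (tri<; tri≈; tri>)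
open import Relation.Binary.PropositionalEquality
open import Relation.Nullary using (¬_; Dec; yes; no; contradiction; does; ¬?; _×-dec_)
open import Relation.Nullary.Decidable using (dec-true; dec-false)

private
  variable
    A B C P : Set
    m n d : ℕ

-- Finite sums and products

∑ : List A → (A → ℕ) → ℕ
∑ []       g = 0
∑ (x ∷ xs) g = g x + ∑ xs g

∑-cong : ∀ (xs : List A) {g h : A → ℕ} → (∀ x → g x ≡ h x) → ∑ xs g ≡ ∑ xs h
∑-cong []       e = refl
∑-cong (x ∷ xs) e = cong₂ _+_ (e x) (∑-cong xs e)

∑-mono-≤ : ∀ (xs : List A) {g h : A → ℕ} → (∀ x → g x ≤ h x) → ∑ xs g ≤ ∑ xs h
∑-mono-≤ []       e = z≤n
∑-mono-≤ (x ∷ xs) e = +-mono-≤ (e x) (∑-mono-≤ xs e)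

∑-distrib-+ : ∀ (xs : List A) (g h : A → ℕ) → ∑ xs (λ x → g x + h x) ≡ ∑ xs g + ∑ xs h
∑-distrib-+ []       g h = refl
∑-distrib-+ (x ∷ xs) g h rewrite ∑-distrib-+ xs g h = interchange (g x) (h x) (∑ xs g) (∑ xs h)
  where
  interchange : ∀ a b c e → (a + b) + (c + e) ≡ (a + c) + (b + e)
  interchange = solve-∀

∑-*ʳ : ∀ (xs : List A) (g : A → ℕ) a → ∑ xs g * a ≡ ∑ xs (λ x → g x * a)
∑-*ʳ []       g a = refl
∑-*ʳ (x ∷ xs) g a = trans (*-distribʳ-+ a (g x) (∑ xs g)) (cong (g x * a +_) (∑-*ʳ xs g a))

∑-*ˡ : ∀ (xs : List A) (g : A → ℕ) a → a * ∑ xs g ≡ ∑ xs (λ x → a * g x)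
∑-*ˡ xs g a = trans (*-comm a _) (trans (∑-*ʳ xs g a) (∑-cong xs λ x → *-comm (g x) a))

∑-const : ∀ (xs : List A) a → ∑ xs (λ _ → a) ≡ length xs * a
∑-const []       a = refl
∑-const (x ∷ xs) a = cong (a +_) (∑-const xs a)

∑-zero : ∀ (xs : List A) → ∑ xs (λ _ → 0) ≡ 0
∑-zero []       = refl
∑-zero (x ∷ xs) = ∑-zero xs

∑-swap : ∀ (xs : List A) (ys : List B) (g : A → B → ℕ) →
         ∑ xs (λ x → ∑ ys (g x)) ≡ ∑ ys (λ y → ∑ xs (λ x → g x y))
∑-swap []       ys g = sym (∑-zero ys)
∑-swap (x ∷ xs) ys g =
  trans (cong (∑ ys (g x) +_) (∑-swap xs ys g)) (sym (∑-distrib-+ ys (g x) _))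

∑-++ : ∀ (xs ys : List A) (g : A → ℕ) → ∑ (xs ++ ys) g ≡ ∑ xs g + ∑ ys g
∑-++ []       ys g = refl
∑-++ (x ∷ xs) ys g = trans (cong (g x +_) (∑-++ xs ys g)) (sym (+-assoc (g x) _ _))

∑-map : ∀ (f : A → B) xs (g : B → ℕ) → ∑ (map f xs) g ≡ ∑ xs (g ∘ f)
∑-map f []       g = refl
∑-map f (x ∷ xs) g = cong (g (f x) +_) (∑-map f xs g)

∑-cartesianProductWith : ∀ (f : A → B → C) xs ys (g : C → ℕ) →
  ∑ (cartesianProductWith f xs ys) g ≡ ∑ xs (λ x → ∑ ys (λ y → g (f x y)))
∑-cartesianProductWith f []       ys g = refl
∑-cartesianProductWith f (x ∷ xs) ys g =
  trans (∑-++ (map (f x) ys) _ g) (cong₂ _+_ (∑-map (f x) ys g) (∑-cartesianProductWith f xs ys g))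

∑-tabulate : ∀ (f : Fin m → A) (h : Fin m → B) (g : A → ℕ) (g′ : B → ℕ) → (∀ i → g (f i) ≡ g′ (h i)) →
             ∑ (tabulateˡ f) g ≡ ∑ (tabulateˡ h) g′
∑-tabulate {m = zero}  f h g g′ e = refl
∑-tabulate {m = suc m} f h g g′ e = cong₂ _+_ (e zero) (∑-tabulate (f ∘ suc) (h ∘ suc) g g′ (e ∘ suc))

∑-allFin-suc : ∀ m (g : Fin (suc m) → ℕ) → ∑ (allFin (suc m)) g ≡ g zero + ∑ (allFin m) (g ∘ suc)
∑-allFin-suc m g = cong (g zero +_) (∑-tabulate suc id g (g ∘ suc) (λ _ → refl))

term≤∑ : ∀ {xs : List A} {x} (g : A → ℕ) → x ∈ˡ xs → g x ≤ ∑ xs g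
term≤∑ g (here refl) = m≤m+n _ _
term≤∑ g (there x∈)  = ≤-trans (term≤∑ g x∈) (m≤n+m _ _)

∑≡0⇒term≡0 : ∀ {xs : List A} {x} (g : A → ℕ) → ∑ xs g ≡ 0 → x ∈ˡ xs → g x ≡ 0
∑≡0⇒term≡0 g e x∈ = n≤0⇒n≡0 (subst (g _ ≤_) e (term≤∑ g x∈))

-- The first-moment method: values averaging below 1 cannot all be positive.
∑<length⇒∃zero : ∀ (xs : List A) (g : A → ℕ) → ∑ xs g < length xs → ∃ λ x → g x ≡ 0
∑<length⇒∃zero (x ∷ xs) g lt with g x in eq
... | zero  = x , eq
... | suc a = ∑<length⇒∃zero xs g (≤-trans (s≤s (m≤n+m _ a)) (≤-pred lt))

∏ : (Fin m → ℕ) → ℕ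
∏ {zero}  g = 1
∏ {suc m} g = g zero * ∏ (g ∘ suc)

∏-cong : ∀ {g h : Fin m → ℕ} → (∀ i → g i ≡ h i) → ∏ g ≡ ∏ h
∏-cong {zero}  e = refl
∏-cong {suc m} e = cong₂ _*_ (e zero) (∏-cong (e ∘ suc))

∏-mono-≤ : ∀ {g h : Fin m → ℕ} → (∀ i → g i ≤ h i) → ∏ g ≤ ∏ h
∏-mono-≤ {zero}  e = ≤-refl
∏-mono-≤ {suc m} e = *-mono-≤ (e zero) (∏-mono-≤ (e ∘ suc))

∏-const : ∀ m a → ∏ {m} (λ _ → a) ≡ a ^ m
∏-const zero    a = refl
∏-const (suc m) a = cong (a *_) (∏-const m a)

∏≡0⇒∃zero : ∀ (g : Fin m → ℕ) → ∏ g ≡ 0 → ∃ λ i → g i ≡ 0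
∏≡0⇒∃zero {suc m} g e with g zero in eq
... | zero  = zero , eq
... | suc a with ∏≡0⇒∃zero (g ∘ suc) (m*n≡0⇒m≡0 _ (suc a) (trans (*-comm _ (suc a)) e))
... | i , z = suc i , z

-- The factor `b ^ ∣ S ∣` on the left replaces an exponent `n - ∣ S ∣` on the right, so that no
-- truncated subtraction occurs.
∏-if : ∀ (S : Subset n) a b →
       ∏ (λ v → if lookup S v then a else b) * b ^ ∣ S ∣ ≡ a ^ ∣ S ∣ * b ^ n
∏-if []          a b = refl
∏-if (true ∷ S)  a b = trans (assoc₁ a _ b _) (trans (cong (a * b *_) (∏-if S a b)) (assoc₂ a b _ _))
  where
  assoc₁ : ∀ a p b q → a * p * (b * q) ≡ a * b * (p * q)
  assoc₁ = solve-∀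
  assoc₂ : ∀ a b p q → a * b * (p * q) ≡ a * p * (b * q)
  assoc₂ = solve-∀
∏-if (false ∷ S) a b = trans (*-assoc b _ _) (trans (cong (b *_) (∏-if S a b)) (rot b (a ^ ∣ S ∣) _))
  where
  rot : ∀ b p q → b * (p * q) ≡ p * (b * q)
  rot = solve-∀

∏-if-1 : ∀ (S : Subset n) a → ∏ (λ v → if lookup S v then a else 1) ≡ a ^ ∣ S ∣
∏-if-1 {n} S a = begin
  p                  ≡⟨ *-identityʳ p ⟨
  p * 1              ≡⟨ cong (p *_) (^-zeroˡ ∣ S ∣) ⟨
  p * 1 ^ ∣ S ∣      ≡⟨ ∏-if S a 1 ⟩
  a ^ ∣ S ∣ * 1 ^ n  ≡⟨ cong (a ^ ∣ S ∣ *_) (^-zeroˡ n) ⟩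
  a ^ ∣ S ∣ * 1      ≡⟨ *-identityʳ _ ⟩
  a ^ ∣ S ∣          ∎
  where
  open ≡-Reasoning
  p = ∏ (λ v → if lookup S v then a else 1)

∑-if : ∀ (S : Subset n) a b →
       ∑ (allFin n) (λ v → if lookup S v then a else b) + ∣ S ∣ * b ≡ ∣ S ∣ * a + n * b
∑-if [] a b = refl
∑-if {suc n} (true ∷ S) a b
  rewrite ∑-allFin-suc n (λ v → if lookup (true ∷ S) v then a else b)
  = trans (shuffle₁ a _ b _) (trans (cong (a + b +_) (∑-if S a b)) (shuffle₂ a b _ _))
  where
  shuffle₁ : ∀ a p b q → a + p + (b + q) ≡ a + b + (p + q)
  shuffle₁ = solve-∀
  shuffle₂ : ∀ a b p q → a + b + (p + q) ≡ a + p + (b + q)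
  shuffle₂ = solve-∀
∑-if {suc n} (false ∷ S) a b
  rewrite ∑-allFin-suc n (λ v → if lookup (false ∷ S) v then a else b)
  = trans (+-assoc b _ _) (trans (cong (b +_) (∑-if S a b)) (rot b (∣ S ∣ * a) _))
  where
  rot : ∀ b p q → b + (p + q) ≡ p + (b + q)
  rot = solve-∀

vecs : List A → (m : ℕ) → List (Vec A m)
vecs L zero    = [] ∷ []
vecs L (suc m) = cartesianProductWith _∷_ L (vecs L m)

∈-vecs : ∀ (L : List A) → (∀ x → x ∈ˡ L) → (xs : Vec A m) → xs ∈ˡ vecs L m
∈-vecs L all []       = here refl
∈-vecs L all (x ∷ xs) = ∈-cartesianProductWith⁺ _∷_ (all x) (∈-vecs L all xs)

-- Independence of coordinates in counting form: the distributive law, applied one coordinate at a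
-- time.
∑-vecs-∏ : ∀ (L : List A) (w : Fin m → A → ℕ) →
           ∑ (vecs L m) (λ x → ∏ (λ i → w i (lookup x i))) ≡ ∏ (λ i → ∑ L (w i))
∑-vecs-∏ {m = zero}  L w = refl
∑-vecs-∏ {m = suc m} L w = begin
  ∑ (vecs L (suc m)) (λ x → ∏ (λ i → w i (lookup x i)))
    ≡⟨ ∑-cartesianProductWith _∷_ L (vecs L m) _ ⟩
  ∑ L (λ x → ∑ (vecs L m) (λ xs → w zero x * ∏ (λ i → w (suc i) (lookup xs i))))
    ≡⟨ ∑-cong L (λ x → trans (sym (∑-*ˡ (vecs L m) _ (w zero x)))
                             (cong (w zero x *_) (∑-vecs-∏ L (w ∘ suc)))) ⟩
  ∑ L (λ x → w zero x * ∏ (λ i → ∑ L (w (suc i))))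
    ≡⟨ ∑-*ʳ L (w zero) _ ⟨
  ∏ (λ i → ∑ L (w i)) ∎
  where open ≡-Reasoning

∑-1 : ∀ (xs : List A) → ∑ xs (λ _ → 1) ≡ length xs
∑-1 xs = trans (∑-const xs 1) (*-identityʳ _)

length-vecs : ∀ (L : List A) m → length (vecs L m) ≡ length L ^ m
length-vecs L m = begin
  length (vecs L m)                        ≡⟨ ∑-1 (vecs L m) ⟨
  ∑ (vecs L m) (λ _ → 1)                   ≡⟨ ∑-cong (vecs L m) (λ _ → trans (sym (^-zeroˡ m)) (sym (∏-const m 1))) ⟩
  ∑ (vecs L m) (λ _ → ∏ {m} (λ _ → 1))     ≡⟨ ∑-vecs-∏ {m = m} L (λ _ _ → 1) ⟩
  ∏ {m} (λ _ → ∑ L (λ _ → 1))              ≡⟨ ∏-const m _ ⟩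
  ∑ L (λ _ → 1) ^ m                        ≡⟨ cong (_^ m) (∑-1 L) ⟩
  length L ^ m                             ∎
  where open ≡-Reasoning

length-allFin : ∀ m → length (allFin m) ≡ m
length-allFin m = length-tabulate id

-- Elementary inequalities

^-distribʳ-* : ∀ a b m → (a * b) ^ m ≡ a ^ m * b ^ m
^-distribʳ-* a b zero    = refl
^-distribʳ-* a b (suc m) rewrite ^-distribʳ-* a b m = interchange a b (a ^ m) (b ^ m)
  where
  interchange : ∀ a b p q → a * b * (p * q) ≡ a * p * (b * q)
  interchange = solve-∀

bernoulli : ∀ a b m → a ^ suc m + suc m * (a ^ m * b) ≤ (a + b) ^ suc m
bernoulli a b zero    = ≤-reflexive (base a b)
  where
  base : ∀ a b → a * 1 + 1 * (1 * b) ≡ (a + b) * 1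
  base = solve-∀
bernoulli a b (suc m) = begin
  a * (a * p) + suc (suc m) * (a * p * b)                                  ≤⟨ m≤m+n _ _ ⟩
  a * (a * p) + suc (suc m) * (a * p * b) + suc m * (p * b * b)            ≡⟨ expand a b m p ⟩
  (a + b) * (a * p + suc m * (p * b))                                      ≤⟨ *-monoʳ-≤ (a + b) (bernoulli a b m) ⟩
  (a + b) * (a + b) ^ suc m                                                ∎
  where
  open ≤-Reasoning
  p = a ^ m
  expand : ∀ a b m p → a * (a * p) + (2 + m) * (a * p * b) + (1 + m) * (p * b * b)
                     ≡ (a + b) * (a * p + (1 + m) * (p * b))
  expand = solve-∀

-- The second Bernoulli term is already at least `a ^ K`, because `K * b ≥ a`. With `a` vertices
-- outside `Y` and `b` inside, it says that `K` draws at least halve the chance of missing `Y`.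
2*a^K≤[a+b]^K : ∀ K .{{_ : NonZero K}} a b → a + b ≤ K * b → 2 * a ^ K ≤ (a + b) ^ K
2*a^K≤[a+b]^K (suc m) a b le = begin
  2 * (a * p)                  ≡⟨ twice a p ⟩
  a * p + p * a                ≤⟨ +-monoʳ-≤ (a * p) (*-monoʳ-≤ p (≤-trans (m≤m+n a b) le)) ⟩
  a * p + p * (suc m * b)      ≡⟨ cong (a * p +_) (rot p (suc m) b) ⟩
  a * p + suc m * (p * b)      ≤⟨ bernoulli a b m ⟩
  (a + b) ^ suc m              ∎
  where
  open ≤-Reasoning
  p = a ^ m
  twice : ∀ a p → 2 * (a * p) ≡ a * p + p * a
  twice = solve-∀
  rot : ∀ p k b → p * (k * b) ≡ k * (p * b)
  rot = solve-∀

-- (1 + 1/r)^j ≤ 1 / (1 − j/r)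
[1+r]^j*i≤r^j*r : ∀ j i r → i + j ≡ r → suc r ^ j * i ≤ r ^ j * r
[1+r]^j*i≤r^j*r zero    i r e = begin
  1 * i  ≤⟨ *-monoʳ-≤ 1 (≤-trans (m≤m+n i 0) (≤-reflexive e)) ⟩
  1 * r  ∎
  where open ≤-Reasoning
[1+r]^j*i≤r^j*r (suc j) i r e = begin
  suc r * p * i        ≡⟨ split r p i ⟩
  p * (i + r * i)      ≤⟨ *-monoʳ-≤ p (+-monoˡ-≤ (r * i) (≤-trans (m≤m+n i (suc j)) (≤-reflexive e))) ⟩
  p * (r + r * i)      ≡⟨ regroup r p i ⟩
  r * (p * suc i)      ≤⟨ *-monoʳ-≤ r ([1+r]^j*i≤r^j*r j (suc i) r (trans (sym (+-suc i j)) e)) ⟩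
  r * (r ^ j * r)      ≡⟨ *-assoc r (r ^ j) r ⟨
  r * r ^ j * r        ∎
  where
  open ≤-Reasoning
  p = suc r ^ j
  split : ∀ r p i → (1 + r) * p * i ≡ p * (i + r * i)
  split = solve-∀
  regroup : ∀ r p i → p * (r + r * i) ≡ r * (p * (1 + i))
  regroup = solve-∀

-- The preceding bound at `j = h`, half of `r = 2 * h`, where its right side is exactly 2.
[1+2h]^h≤2*[2h]^h : ∀ h .{{_ : NonZero h}} → suc (2 * h) ^ h ≤ 2 * (2 * h) ^ h
[1+2h]^h≤2*[2h]^h h = *-cancelʳ-≤ _ _ h (begin
  suc (2 * h) ^ h * h      ≤⟨ [1+r]^j*i≤r^j*r h h (2 * h) (cong (h +_) (sym (+-identityʳ h))) ⟩
  (2 * h) ^ h * (2 * h)    ≡⟨ rot ((2 * h) ^ h) h ⟩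
  2 * (2 * h) ^ h * h      ∎)
  where
  open ≤-Reasoning
  rot : ∀ p h → p * (2 * h) ≡ 2 * p * h
  rot = solve-∀

-- For `a ≤ b` the ratio `(b / a) ^ m` grows with `m`, so a bound at `e` passes down to `m`.
^-ratio-shrink : ∀ a b c {m e} .{{_ : NonZero a}} → a ≤ b → m ≤ e → b ^ e ≤ c * a ^ e → b ^ m ≤ c * a ^ m
^-ratio-shrink a b c {m} a≤b m≤e le with m≤n⇒∃[o]m+o≡n m≤e
... | t , refl = *-cancelʳ-≤ _ _ (a ^ t) {{m^n≢0 a t}} (begin
  b ^ m * a ^ t          ≤⟨ *-monoʳ-≤ (b ^ m) (^-monoˡ-≤ t a≤b) ⟩
  b ^ m * b ^ t          ≡⟨ ^-distribˡ-+-* b m t ⟨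
  b ^ (m + t)            ≤⟨ le ⟩
  c * a ^ (m + t)        ≡⟨ cong (c *_) (^-distribˡ-+-* a m t) ⟩
  c * (a ^ m * a ^ t)    ≡⟨ *-assoc c _ _ ⟨
  c * a ^ m * a ^ t      ∎)
  where open ≤-Reasoning

-- The bound for exponent `h`, raised to the power `4 * s`. With `m = n` and `2 * h` about `n / s`
-- it controls the number of sets of size `s`.
[1+2h]^m≤16^s*[2h]^m : ∀ h s m .{{_ : NonZero h}} → m ≤ h * (4 * s) →
                       suc (2 * h) ^ m ≤ 16 ^ s * (2 * h) ^ m
[1+2h]^m≤16^s*[2h]^m h@(suc _) s m m≤ = ^-ratio-shrink r (suc r) (16 ^ s) (n≤1+n r) m≤ (begin
  suc r ^ (h * (4 * s))              ≡⟨ ^-*-assoc (suc r) h (4 * s) ⟨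
  (suc r ^ h) ^ (4 * s)              ≤⟨ ^-monoˡ-≤ (4 * s) ([1+2h]^h≤2*[2h]^h h) ⟩
  (2 * r ^ h) ^ (4 * s)              ≡⟨ ^-distribʳ-* 2 (r ^ h) (4 * s) ⟩
  2 ^ (4 * s) * (r ^ h) ^ (4 * s)    ≡⟨ cong₂ _*_ (sym (^-*-assoc 2 4 s)) (^-*-assoc r h (4 * s)) ⟩
  16 ^ s * r ^ (h * (4 * s))         ∎)
  where
  open ≤-Reasoning
  r = 2 * h

-- Since `γ i ≤ N / 4 ^ (i + 1)`, three times the sum is at most `N * (1 - 1 / 4 ^ M)`. Here this is
-- multiplied by `4 ^ M`; the `+ N` on the left later yields a strict inequality.
geometric-sum : ∀ N (γ : ℕ → ℕ) M → (∀ i → i < M → γ i * 4 ^ suc i ≤ N) →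
                4 ^ M * (3 * ∑ (downFrom M) γ) + N ≤ 4 ^ M * N
geometric-sum N γ zero    h = ≤-reflexive (sym (+-identityʳ N))
geometric-sum N γ (suc M) h = begin
  4 * p * (3 * (γ M + σ)) + N            ≡⟨ split p (γ M) σ N ⟩
  4 * (p * (3 * σ)) + N + 3 * (γ M * (4 * p))  ≤⟨ +-monoʳ-≤ (4 * (p * (3 * σ)) + N) (*-monoʳ-≤ 3 (h M ≤-refl)) ⟩
  4 * (p * (3 * σ)) + N + 3 * N          ≡⟨ regroup (p * (3 * σ)) N ⟩
  4 * (p * (3 * σ) + N)                  ≤⟨ *-monoʳ-≤ 4 (geometric-sum N γ M (λ i i<M → h i (m≤n⇒m≤1+n i<M))) ⟩
  4 * (p * N)                            ≡⟨ *-assoc 4 p N ⟨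
  4 * p * N                              ∎
  where
  open ≤-Reasoning
  p = 4 ^ M
  σ = ∑ (downFrom M) γ
  split : ∀ p g σ N → 4 * p * (3 * (g + σ)) + N ≡ 4 * (p * (3 * σ)) + N + 3 * (g * (4 * p))
  split = solve-∀
  regroup : ∀ x N → 4 * x + N + 3 * N ≡ 4 * (x + N)
  regroup = solve-∀

-- Counting choices of out-neighbours

indicator : Dec P → ℕ
indicator (yes _) = 1
indicator (no _)  = 0

indicator*-≤ : ∀ (P? : Dec P) {a b} → (P → a ≤ b) → indicator P? * a ≤ b
indicator*-≤ (yes p) {a} le = ≤-trans (≤-reflexive (+-identityʳ a)) (le p)
indicator*-≤ (no _)      le = z≤n

indicator*≡0 : ∀ (P? : Dec P) {a} → indicator P? * a ≡ 0 → P → a ≡ 0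
indicator*≡0 (yes _) {a} e p = trans (sym (+-identityʳ a)) e
indicator*≡0 (no ¬p)     e p = contradiction p ¬p

indicator≡0 : ∀ (P? : Dec P) → indicator P? ≡ 0 → ¬ P
indicator≡0 (no ¬p) e = ¬p

-- Row u lists the out-neighbours chosen by the vertex u, with repetitions and possibly u itself.
Choice : ℕ → ℕ → Set
Choice n d = Vec (Vec (Fin n) d) n

choices : ∀ n d → List (Choice n d)
choices n d = vecs (vecs (allFin n) d) n

subsets : ∀ n → List (Subset n)
subsets n = vecs (true ∷ false ∷ []) n

∈-subsets : ∀ (S : Subset n) → S ∈ˡ subsets n
∈-subsets = ∈-vecs _ λ { true → here refl ; false → there (here refl) }

length-subsets : ∀ n → length (subsets n) ≡ 2 ^ n
length-subsets n = length-vecs (true ∷ false ∷ []) n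

length-choices : ∀ n d → length (choices n d) ≡ (n ^ d) ^ n
length-choices n d = trans (length-vecs (vecs (allFin n) d) n)
  (cong (_^ n) (trans (length-vecs (allFin n) d) (cong (_^ d) (length-allFin n))))

rowWeight : (Fin n → ℕ) → Vec (Fin n) d → ℕ
rowWeight y row = ∏ (λ j → y (lookup row j))

-- With `avoid Y` this is 1 or 0 according to whether all rows of `X` miss `Y`. With `boost r S` it
-- is `r` to the number of entries in `S`, over the rows of `X`.
weight : Subset n → (Fin n → ℕ) → Choice n d → ℕ
weight X y f = ∏ (λ u → if lookup X u then rowWeight y (lookup f u) else 1)

∑-weight : ∀ d (X : Subset n) y → ∑ (choices n d) (weight X y) * (n ^ d) ^ ∣ X ∣
                                ≡ (∑ (allFin n) y ^ d) ^ ∣ X ∣ * (n ^ d) ^ n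
∑-weight {n} d X y = trans (cong (_* (n ^ d) ^ ∣ X ∣) eq) (∏-if X (∑ (allFin n) y ^ d) (n ^ d))
  where
  rows = vecs (allFin n) d
  rowSum : ∀ b → ∑ rows (λ row → if b then rowWeight y row else 1) ≡ (if b then ∑ (allFin n) y ^ d else n ^ d)
  rowSum true  = trans (∑-vecs-∏ {m = d} (allFin n) (λ _ → y)) (∏-const d _)
  rowSum false = trans (∑-1 rows) (trans (length-vecs (allFin n) d) (cong (_^ d) (length-allFin n)))
  eq : ∑ (choices n d) (weight X y) ≡ ∏ (λ u → if lookup X u then ∑ (allFin n) y ^ d else n ^ d)
  eq = trans (∑-vecs-∏ rows (λ u row → if lookup X u then rowWeight y row else 1)) (∏-cong (λ u → rowSum (lookup X u)))

-- Mean weights multiply over independent rows, so a bound `p / q` for one row acquires the exponent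
-- `∣ X ∣`.
∑-weight-≤ : ∀ d (X : Subset n) y p q .{{_ : NonZero n}} → q * ∑ (allFin n) y ^ d ≤ p * n ^ d →
             q ^ ∣ X ∣ * ∑ (choices n d) (weight X y) ≤ p ^ ∣ X ∣ * (n ^ d) ^ n
∑-weight-≤ {n} d X y p q le = *-cancelʳ-≤ _ _ (N₁ ^ x) {{m^n≢0 N₁ x {{m^n≢0 n d}}}} (begin
  q ^ x * W * N₁ ^ x                ≡⟨ *-assoc (q ^ x) W _ ⟩
  q ^ x * (W * N₁ ^ x)              ≡⟨ cong (q ^ x *_) (∑-weight d X y) ⟩
  q ^ x * ((σ ^ d) ^ x * N₁ ^ n)    ≡⟨ *-assoc (q ^ x) _ _ ⟨
  q ^ x * (σ ^ d) ^ x * N₁ ^ n      ≡⟨ cong (_* N₁ ^ n) (^-distribʳ-* q (σ ^ d) x) ⟨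
  (q * σ ^ d) ^ x * N₁ ^ n          ≤⟨ *-monoˡ-≤ (N₁ ^ n) (^-monoˡ-≤ x le) ⟩
  (p * N₁) ^ x * N₁ ^ n             ≡⟨ cong (_* N₁ ^ n) (^-distribʳ-* p N₁ x) ⟩
  p ^ x * N₁ ^ x * N₁ ^ n           ≡⟨ rot (p ^ x) (N₁ ^ x) (N₁ ^ n) ⟩
  p ^ x * N₁ ^ n * N₁ ^ x           ∎)
  where
  open ≤-Reasoning
  x = ∣ X ∣
  N₁ = n ^ d
  σ = ∑ (allFin n) y
  W = ∑ (choices n d) (weight X y)
  rot : ∀ a b c → a * b * c ≡ a * c * b
  rot = solve-∀

-- Expected weights of the two kinds of bad event

avoid : Subset n → Fin n → ℕ
avoid Y v = if lookup Y v then 0 else 1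

∑-avoid : ∀ (Y : Subset n) → ∑ (allFin n) (avoid Y) + ∣ Y ∣ ≡ n
∑-avoid {n} Y = begin
  ∑ (allFin n) (avoid Y) + ∣ Y ∣      ≡⟨ cong (∑ (allFin n) (avoid Y) +_) (*-identityʳ ∣ Y ∣) ⟨
  ∑ (allFin n) (avoid Y) + ∣ Y ∣ * 1  ≡⟨ ∑-if Y 0 1 ⟩
  ∣ Y ∣ * 0 + n * 1                   ≡⟨ cong₂ _+_ (*-zeroʳ ∣ Y ∣) (*-identityʳ n) ⟩
  n                                   ∎
  where open ≡-Reasoning

boost : ℕ → Subset n → Fin n → ℕ
boost r S v = if lookup S v then r else 1

∑-boost-≤ : ∀ r (S : Subset n) → ∣ S ∣ * r ≤ n → ∑ (allFin n) (boost r S) ≤ 2 * n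
∑-boost-≤ {n} r S le = begin
  ∑ (allFin n) (boost r S)             ≤⟨ m≤m+n _ _ ⟩
  ∑ (allFin n) (boost r S) + ∣ S ∣ * 1 ≡⟨ ∑-if S r 1 ⟩
  ∣ S ∣ * r + n * 1                    ≤⟨ +-monoˡ-≤ (n * 1) le ⟩
  n + n * 1                            ≡⟨ cong (n +_) (*-comm n 1) ⟩
  2 * n                                ∎
  where open ≤-Reasoning

-- Every `K` draws at least halve the chance of missing `Y`, so a row of `K * (3 * K)` draws misses
-- it with chance at most `1 / 2 ^ (3 * K)`. The rows of `X`, at least `n / K` many, bring this to
-- `1 / 8 ^ n`, which beats the `4 ^ n` pairs.
∑-avoid-weight-≤ : ∀ K .{{_ : NonZero K}} .{{_ : NonZero n}} (X Y : Subset n) → n ≤ K * ∣ X ∣ → n ≤ K * ∣ Y ∣ →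
  8 ^ n * ∑ (choices n (K * (3 * K))) (weight X (avoid Y)) ≤ (n ^ (K * (3 * K))) ^ n
∑-avoid-weight-≤ {n} K X Y hX hY = begin
  8 ^ n * W                ≤⟨ *-monoˡ-≤ W 8^n≤ ⟩
  (2 ^ c) ^ ∣ X ∣ * W      ≤⟨ ∑-weight-≤ K*c X (avoid Y) 1 (2 ^ c) per-row ⟩
  1 ^ ∣ X ∣ * (n ^ K*c) ^ n  ≡⟨ trans (cong (_* (n ^ K*c) ^ n) (^-zeroˡ ∣ X ∣)) (*-identityˡ _) ⟩
  (n ^ K*c) ^ n              ∎
  where
  open ≤-Reasoning
  c = 3 * K
  K*c = K * c
  W = ∑ (choices n K*c) (weight X (avoid Y))
  σ = ∑ (allFin n) (avoid Y)
  8^n≤ : 8 ^ n ≤ (2 ^ c) ^ ∣ X ∣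
  8^n≤ = begin
    (2 ^ 3) ^ n          ≡⟨ ^-*-assoc 2 3 n ⟩
    2 ^ (3 * n)          ≤⟨ ^-monoʳ-≤ 2 (*-monoʳ-≤ 3 hX) ⟩
    2 ^ (3 * (K * ∣ X ∣)) ≡⟨ cong (2 ^_) (*-assoc 3 K ∣ X ∣) ⟨
    2 ^ (c * ∣ X ∣)      ≡⟨ ^-*-assoc 2 c ∣ X ∣ ⟨
    (2 ^ c) ^ ∣ X ∣      ∎
  2σ^K≤n^K : 2 * σ ^ K ≤ n ^ K
  2σ^K≤n^K = subst (λ z → 2 * σ ^ K ≤ z ^ K) (∑-avoid Y)
    (2*a^K≤[a+b]^K K σ ∣ Y ∣ (≤-trans (≤-reflexive (∑-avoid Y)) hY))
  per-row : 2 ^ c * σ ^ K*c ≤ 1 * n ^ K*c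
  per-row = begin
    2 ^ c * σ ^ (K * c)    ≡⟨ cong (2 ^ c *_) (^-*-assoc σ K c) ⟨
    2 ^ c * (σ ^ K) ^ c    ≡⟨ ^-distribʳ-* 2 (σ ^ K) c ⟨
    (2 * σ ^ K) ^ c        ≤⟨ ^-monoˡ-≤ c 2σ^K≤n^K ⟩
    (n ^ K) ^ c            ≡⟨ ^-*-assoc n K c ⟩
    n ^ K*c                  ≡⟨ *-identityˡ _ ⟨
    1 * n ^ K*c              ∎

-- The summand is `r ^ (n - ∣ S ∣)`, so this is the binomial theorem. It serves to bound the number
-- of sets of a given size without binomial coefficients.
∑-subsets-∏ : ∀ n r → ∑ (subsets n) (λ S → ∏ (λ v → if lookup S v then 1 else r)) ≡ suc r ^ n
∑-subsets-∏ n r = trans (∑-vecs-∏ {m = n} (true ∷ false ∷ []) (λ _ b → if b then 1 else r))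
  (trans (∏-const n _) (cong (λ z → suc z ^ n) (+-identityʳ r)))

-- About n / suc s, rounded to an even number so that [1+2h]^h≤2*[2h]^h applies.
boostAt : ℕ → ℕ → ℕ
boostAt n s = 2 * (n / (2 * suc s))

-- Sizes are shifted by one: the parameter s stands for sets of size suc s.
dense : ∀ s → Subset n → Choice n d → ℕ
dense {n} s S f = indicator (∣ S ∣ ≟ suc s)
                * indicator ((r ^ 2) ^ suc s ≤? weight S (boost r S) f)
  where r = boostAt n s

-- Markov's inequality: threshold times indicator is at most the weight. The factor `r ^ n` turns
-- the size condition on `S` into a product over vertices, which can then be summed over all `S`.
∑-dense-≤ : ∀ d s (S : Subset n) .{{_ : NonZero n}} → let r = boostAt n s in
  ∑ (choices n d) (dense s S) * (r ^ 2) ^ suc s * r ^ n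
    ≤ (2 ^ d) ^ suc s * (n ^ d) ^ n * r ^ suc s * ∏ (λ v → if lookup S v then 1 else r)
∑-dense-≤ {n} d s S with ∣ S ∣ ≟ suc s
... | no _  = ≤-trans (≤-reflexive (cong (λ z → z * (r ^ 2) ^ suc s * r ^ n) (∑-zero (choices n d)))) z≤n
  where r = boostAt n s
... | yes e = begin
  ∑ (choices n d) (λ f → 1 * indicator (bad? f)) * q * r ^ n
    ≡⟨ cong (_* r ^ n) (∑-*ʳ (choices n d) _ q) ⟩
  ∑ (choices n d) (λ f → 1 * indicator (bad? f) * q) * r ^ n
    ≤⟨ *-monoˡ-≤ (r ^ n) (∑-mono-≤ (choices n d) (λ f →
         ≤-trans (≤-reflexive (cong (_* q) (*-identityˡ (indicator (bad? f))))) (indicator*-≤ (bad? f) id))) ⟩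
  W * r ^ n
    ≤⟨ *-monoˡ-≤ (r ^ n) W≤ ⟩
  (2 ^ d) ^ suc s * (n ^ d) ^ n * r ^ n
    ≡⟨ cong ((2 ^ d) ^ suc s * (n ^ d) ^ n *_) r^n≡ ⟩
  (2 ^ d) ^ suc s * (n ^ d) ^ n * (r ^ suc s * p)
    ≡⟨ *-assoc ((2 ^ d) ^ suc s * (n ^ d) ^ n) (r ^ suc s) p ⟨
  (2 ^ d) ^ suc s * (n ^ d) ^ n * r ^ suc s * p ∎
  where
  open ≤-Reasoning
  r = boostAt n s
  q = (r ^ 2) ^ suc s
  p = ∏ (λ v → if lookup S v then 1 else r)
  W = ∑ (choices n d) (weight S (boost r S))
  bad? : ∀ f → Dec (q ≤ weight S (boost r S) f)
  bad? f = q ≤? weight S (boost r S) f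
  r^n≡ : r ^ n ≡ r ^ suc s * p
  r^n≡ = trans (sym (*-identityˡ (r ^ n)))
        (trans (cong (_* r ^ n) (sym (^-zeroˡ ∣ S ∣)))
        (trans (sym (∏-if S 1 r)) (trans (*-comm p _) (cong (λ z → r ^ z * p) e))))
  size : ∣ S ∣ * r ≤ n
  size = begin
    ∣ S ∣ * r                               ≡⟨ cong (_* r) e ⟩
    suc s * (2 * (n / (2 * suc s)))         ≡⟨ rot (suc s) (n / (2 * suc s)) ⟩
    n / (2 * suc s) * (2 * suc s)           ≤⟨ m/n*n≤m n (2 * suc s) ⟩
    n                                       ∎
    where
    rot : ∀ a b → a * (2 * b) ≡ b * (2 * a)
    rot = solve-∀
  W≤ : W ≤ (2 ^ d) ^ suc s * (n ^ d) ^ n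
  W≤ = begin
    W                                ≡⟨ trans (cong (_* W) (^-zeroˡ ∣ S ∣)) (*-identityˡ W) ⟨
    1 ^ ∣ S ∣ * W                    ≤⟨ ∑-weight-≤ d S (boost r S) (2 ^ d) 1 (begin
      1 * ∑ (allFin n) (boost r S) ^ d  ≡⟨ *-identityˡ _ ⟩
      ∑ (allFin n) (boost r S) ^ d      ≤⟨ ^-monoˡ-≤ d (∑-boost-≤ r S size) ⟩
      (2 * n) ^ d                       ≡⟨ ^-distribʳ-* 2 n d ⟩
      2 ^ d * n ^ d                     ∎) ⟩
    (2 ^ d) ^ ∣ S ∣ * (n ^ d) ^ n    ≡⟨ cong (λ z → (2 ^ d) ^ z * (n ^ d) ^ n) e ⟩
    (2 ^ d) ^ suc s * (n ^ d) ^ n    ∎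

-- Summing the Markov bound over `S` and using `suc r ^ n ≤ 16 ^ suc s * r ^ n` leaves a fraction
-- `(16 * 2 ^ d / r) ^ suc s` of all choices. The constant 64 makes `r` at least four times
-- `16 * 2 ^ d`.
∑-∑-dense-≤ : ∀ n d s .{{_ : NonZero n}} → 64 * 2 ^ d * suc s ≤ n →
  ∑ (subsets n) (λ S → ∑ (choices n d) (dense s S)) * 4 ^ suc s ≤ (n ^ d) ^ n
∑-∑-dense-≤ n d s le = *-cancelʳ-≤ _ _ (b ^ t) {{m^n≢0 b t {{m*n≢0 16 (2 ^ d) {{_}} {{m^n≢0 2 d}}}}}} (begin
  γ * 4 ^ t * b ^ t        ≡⟨ *-assoc γ (4 ^ t) (b ^ t) ⟩
  γ * (4 ^ t * b ^ t)      ≡⟨ cong (γ *_) (^-distribʳ-* 4 b t) ⟨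
  γ * (4 * b) ^ t          ≤⟨ *-monoʳ-≤ γ (^-monoˡ-≤ t 4b≤r) ⟩
  γ * r ^ t                ≤⟨ *-cancelʳ-≤ _ _ (r ^ t * r ^ n) {{m*n≢0 _ _ {{m^n≢0 r t}} {{m^n≢0 r n}}}} γ-bound ⟩
  (2 ^ d) ^ t * N * 16 ^ t ≡⟨ rot ((2 ^ d) ^ t) N (16 ^ t) ⟩
  N * (16 ^ t * (2 ^ d) ^ t) ≡⟨ cong (N *_) (^-distribʳ-* 16 (2 ^ d) t) ⟨
  N * b ^ t                ∎)
  where
  open ≤-Reasoning
  t = suc s
  h = n / (2 * t)
  r = boostAt n s
  b = 16 * 2 ^ d
  N = (n ^ d) ^ n
  γ = ∑ (subsets n) (λ S → ∑ (choices n d) (dense s S))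
  rot : ∀ a b c → a * b * c ≡ b * (c * a)
  rot = solve-∀
  32*2^d≤h : 32 * 2 ^ d ≤ h
  32*2^d≤h = begin
    32 * 2 ^ d                        ≡⟨ m*n/n≡m (32 * 2 ^ d) (2 * t) ⟨
    32 * 2 ^ d * (2 * t) / (2 * t)    ≤⟨ /-monoˡ-≤ (2 * t) (≤-trans (≤-reflexive (regroup (2 ^ d) t)) le) ⟩
    n / (2 * t)                       ∎
    where
    regroup : ∀ p t → 32 * p * (2 * t) ≡ 64 * p * t
    regroup = solve-∀
  instance
    h≢0 : NonZero h
    h≢0 = >-nonZero (≤-trans (*-mono-≤ {1} {32} (s≤s z≤n) (m^n>0 2 d)) 32*2^d≤h)
    r≢0 : NonZero r
    r≢0 = m*n≢0 2 h
  4b≤r : 4 * b ≤ r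
  4b≤r = ≤-trans (≤-reflexive (regroup (2 ^ d))) (*-monoʳ-≤ 2 32*2^d≤h)
    where
    regroup : ∀ p → 4 * (16 * p) ≡ 2 * (32 * p)
    regroup = solve-∀
  -- As `h` is positive, the remainder is at most `h * (2 * t)`: rounding costs at most a factor 2.
  n≤4ht : n ≤ h * (4 * t)
  n≤4ht = begin
    n                              ≡⟨ m≡m%n+[m/n]*n n (2 * t) ⟩
    n % (2 * t) + h * (2 * t)    ≤⟨ +-monoˡ-≤ (h * (2 * t)) (<⇒≤ (m%n<n n (2 * t))) ⟩
    2 * t + h * (2 * t)            ≤⟨ +-monoˡ-≤ (h * (2 * t)) (m≤n*m (2 * t) h) ⟩
    h * (2 * t) + h * (2 * t)      ≡⟨ regroup h t ⟩
    h * (4 * t)                    ∎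
    where
    regroup : ∀ h t → h * (2 * t) + h * (2 * t) ≡ h * (4 * t)
    regroup = solve-∀
  γ-bound : γ * r ^ t * (r ^ t * r ^ n) ≤ (2 ^ d) ^ t * N * 16 ^ t * (r ^ t * r ^ n)
  γ-bound = begin
    γ * r ^ t * (r ^ t * r ^ n)      ≡⟨ regroup₁ γ (r ^ t) (r ^ n) ⟩
    γ * (r ^ t * r ^ t) * r ^ n      ≡⟨ cong (λ z → γ * z * r ^ n) (^-distribʳ-* r r t) ⟨
    γ * (r * r) ^ t * r ^ n          ≡⟨ cong (λ z → γ * (r * z) ^ t * r ^ n) (*-identityʳ r) ⟨
    γ * (r ^ 2) ^ t * r ^ n
      ≡⟨ trans (cong (_* r ^ n) (∑-*ʳ (subsets n) _ ((r ^ 2) ^ t))) (∑-*ʳ (subsets n) _ (r ^ n)) ⟩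
    ∑ (subsets n) (λ S → ∑ (choices n d) (dense s S) * (r ^ 2) ^ t * r ^ n)
                                     ≤⟨ ∑-mono-≤ (subsets n) (λ S → ∑-dense-≤ d s S) ⟩
    ∑ (subsets n) (λ S → (2 ^ d) ^ t * N * r ^ t * ∏ (λ v → if lookup S v then 1 else r))
                                     ≡⟨ ∑-*ˡ (subsets n) _ ((2 ^ d) ^ t * N * r ^ t) ⟨
    (2 ^ d) ^ t * N * r ^ t * ∑ (subsets n) (λ S → ∏ (λ v → if lookup S v then 1 else r))
                                     ≡⟨ cong ((2 ^ d) ^ t * N * r ^ t *_) (∑-subsets-∏ n r) ⟩
    (2 ^ d) ^ t * N * r ^ t * suc r ^ n
                                     ≤⟨ *-monoʳ-≤ ((2 ^ d) ^ t * N * r ^ t) ([1+2h]^m≤16^s*[2h]^m h t n n≤4ht) ⟩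
    (2 ^ d) ^ t * N * r ^ t * (16 ^ t * r ^ n)
                                     ≡⟨ regroup₂ ((2 ^ d) ^ t * N) (r ^ t) (16 ^ t) (r ^ n) ⟩
    (2 ^ d) ^ t * N * 16 ^ t * (r ^ t * r ^ n) ∎
    where
    regroup₁ : ∀ g a b → g * a * (a * b) ≡ g * (a * a) * b
    regroup₁ = solve-∀
    regroup₂ : ∀ a b c e → a * b * (c * e) ≡ a * c * (b * e)
    regroup₂ = solve-∀

unlinked : ∀ K → Subset n → Subset n → Choice n d → ℕ
unlinked {n} K X Y f = indicator (n ≤? K * ∣ X ∣) * (indicator (n ≤? K * ∣ Y ∣) * weight X (avoid Y) f)

-- Each of the `4 ^ n` pairs takes at most a fraction `1 / 8 ^ n` of the choices; the resulting
-- `1 / 2 ^ n` is at most one half because `n` is positive.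
∑-∑-unlinked-≤ : ∀ n K .{{_ : NonZero n}} .{{_ : NonZero K}} → let d = K * (3 * K) in
  2 * ∑ (subsets n) (λ X → ∑ (subsets n) (λ Y → ∑ (choices n d) (unlinked K X Y))) ≤ (n ^ d) ^ n
∑-∑-unlinked-≤ n@(suc n-1) K = begin
  2 * T            ≡⟨ cong (_* T) (*-identityʳ 2) ⟨
  2 ^ 1 * T        ≤⟨ *-monoˡ-≤ T (^-monoʳ-≤ 2 {1} {n} (s≤s z≤n)) ⟩
  2 ^ n * T        ≤⟨ *-cancelˡ-≤ (2 ^ n * 2 ^ n) {{m*n≢0 (2 ^ n) (2 ^ n) {{m^n≢0 2 n}} {{m^n≢0 2 n}}}} scaled ⟩
  N                ∎
  where
  open ≤-Reasoning
  K*c = K * (3 * K)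
  N = (n ^ K*c) ^ n
  U : Subset n → Subset n → ℕ
  U X Y = ∑ (choices n K*c) (unlinked K X Y)
  T = ∑ (subsets n) (λ X → ∑ (subsets n) (U X))
  termBound : ∀ X Y → 8 ^ n * U X Y ≤ N
  termBound X Y = begin
    8 ^ n * U X Y
      ≡⟨ cong (8 ^ n *_) (sym (trans (cong (iX *_) (∑-*ˡ (choices n K*c) _ iY))
                               (∑-*ˡ (choices n K*c) _ iX))) ⟩
    8 ^ n * (iX * (iY * W))                                ≡⟨ rot (8 ^ n) iX iY W ⟩
    iX * (iY * (8 ^ n * W))
      ≤⟨ indicator*-≤ (n ≤? K * ∣ X ∣) (λ hX →
         indicator*-≤ (n ≤? K * ∣ Y ∣) (λ hY → ∑-avoid-weight-≤ K X Y hX hY)) ⟩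
    N                                                      ∎
    where
    iX = indicator (n ≤? K * ∣ X ∣)
    iY = indicator (n ≤? K * ∣ Y ∣)
    W = ∑ (choices n K*c) (weight X (avoid Y))
    rot : ∀ p a b w → p * (a * (b * w)) ≡ a * (b * (p * w))
    rot = solve-∀
  scaled : 2 ^ n * 2 ^ n * (2 ^ n * T) ≤ 2 ^ n * 2 ^ n * N
  scaled = begin
    2 ^ n * 2 ^ n * (2 ^ n * T)                                         ≡⟨ *-assoc (2 ^ n * 2 ^ n) (2 ^ n) T ⟨
    2 ^ n * 2 ^ n * 2 ^ n * T
      ≡⟨ cong (λ z → z * 2 ^ n * T) (^-distribʳ-* 2 2 n) ⟨
    4 ^ n * 2 ^ n * T                                                   ≡⟨ cong (_* T) (^-distribʳ-* 4 2 n) ⟨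
    8 ^ n * T                                                           ≡⟨ ∑-*ˡ (subsets n) _ (8 ^ n) ⟩
    ∑ (subsets n) (λ X → 8 ^ n * ∑ (subsets n) (U X))
      ≡⟨ ∑-cong (subsets n) (λ X → ∑-*ˡ (subsets n) (U X) (8 ^ n)) ⟩
    ∑ (subsets n) (λ X → ∑ (subsets n) (λ Y → 8 ^ n * U X Y))
      ≤⟨ ∑-mono-≤ (subsets n) (λ X → ∑-mono-≤ (subsets n) (termBound X)) ⟩
    ∑ (subsets n) (λ X → ∑ (subsets n) (λ Y → N))
      ≡⟨ ∑-cong (subsets n) (λ X → ∑-const (subsets n) N) ⟩
    ∑ (subsets n) (λ X → length (subsets n) * N)                        ≡⟨ ∑-const (subsets n) _ ⟩
    length (subsets n) * (length (subsets n) * N)                       ≡⟨ cong (λ z → z * (z * N)) (length-subsets n) ⟩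
    2 ^ n * (2 ^ n * N)                                                 ≡⟨ *-assoc (2 ^ n) (2 ^ n) N ⟨
    2 ^ n * 2 ^ n * N                                                   ∎

-- Existence of a good choice

record Good (K : ℕ) (f : Choice n d) : Set where
  field
    linked : ∀ X Y → n ≤ K * ∣ X ∣ → n ≤ K * ∣ Y ∣ → weight X (avoid Y) f ≡ 0
    sparse : ∀ s (S : Subset n) → 64 * 2 ^ d * suc s ≤ n → ∣ S ∣ ≡ suc s → let r = boostAt n s in
             weight S (boost r S) f < (r ^ 2) ^ suc s

-- The expected number of bad events is at most 1/2 for unlinked pairs plus less than 1/3 for dense
-- sets, hence below 1, so some choice has none.
∃-good : ∀ n K .{{_ : NonZero n}} .{{_ : NonZero K}} → ∃ λ (f : Choice n (K * (3 * K))) → Good K f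
∃-good n K = f , record { linked = linked ; sparse = sparse }
  where
  K*c = K * (3 * K)
  R = 64 * 2 ^ K*c
  instance
    R≢0 : NonZero R
    R≢0 = m*n≢0 64 (2 ^ K*c) {{_}} {{m^n≢0 2 K*c}}
  -- The parameters `s < M` are exactly those with `R * suc s ≤ n`.
  M = n / R
  Ω = choices n K*c
  N = (n ^ K*c) ^ n
  bad₁ bad₂ : Choice n K*c → ℕ
  bad₁ f = ∑ (subsets n) (λ X → ∑ (subsets n) (λ Y → unlinked K X Y f))
  bad₂ f = ∑ (downFrom M) (λ s → ∑ (subsets n) (λ S → dense s S f))
  T₁ = ∑ (subsets n) (λ X → ∑ (subsets n) (λ Y → ∑ Ω (unlinked K X Y)))
  T₂ = ∑ (downFrom M) (λ s → ∑ (subsets n) (λ S → ∑ Ω (dense s S)))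
  bad₁-sum : ∑ Ω bad₁ ≡ T₁
  bad₁-sum = trans (∑-swap Ω (subsets n) _) (∑-cong (subsets n) (λ X → ∑-swap Ω (subsets n) _))
  bad₂-sum : ∑ Ω bad₂ ≡ T₂
  bad₂-sum = trans (∑-swap Ω (downFrom M) _) (∑-cong (downFrom M) (λ s → ∑-swap Ω (subsets n) _))
  N>0 : 0 < N
  N>0 = m^n>0 (n ^ K*c) {{m^n≢0 n K*c}} n
  3T₂<N : 3 * T₂ < N
  3T₂<N = *-cancelˡ-< (4 ^ M) _ _ (<-≤-trans (m<m+n _ N>0)
    (geometric-sum N _ M (λ s s<M → ∑-∑-dense-≤ n K*c s
      (≤-trans (≤-reflexive (*-comm R (suc s))) (≤-trans (*-monoˡ-≤ R s<M) (m/n*n≤m n R))))))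
  total : ∑ Ω (λ f → bad₁ f + bad₂ f) < length Ω
  total = *-cancelˡ-< 2 _ _ (begin-strict
    2 * ∑ Ω (λ f → bad₁ f + bad₂ f)   ≡⟨ cong (2 *_) (trans (∑-distrib-+ Ω bad₁ bad₂) (cong₂ _+_ bad₁-sum bad₂-sum)) ⟩
    2 * (T₁ + T₂)                     ≡⟨ *-distribˡ-+ 2 T₁ T₂ ⟩
    2 * T₁ + 2 * T₂                   ≤⟨ +-mono-≤ (∑-∑-unlinked-≤ n K) (*-monoˡ-≤ T₂ {2} {3} (n≤1+n 2)) ⟩
    N + 3 * T₂                        <⟨ +-monoʳ-< N 3T₂<N ⟩
    N + N                             ≡⟨ cong (N +_) (+-identityʳ N) ⟨
    2 * N                             ≡⟨ cong (2 *_) (length-choices n K*c) ⟨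
    2 * length Ω                      ∎)
    where open ≤-Reasoning
  f = proj₁ (∑<length⇒∃zero Ω _ total)
  bad≡0 : bad₁ f + bad₂ f ≡ 0
  bad≡0 = proj₂ (∑<length⇒∃zero Ω _ total)
  linked : ∀ X Y → n ≤ K * ∣ X ∣ → n ≤ K * ∣ Y ∣ → weight X (avoid Y) f ≡ 0
  linked X Y hX hY = indicator*≡0 (n ≤? K * ∣ Y ∣) (indicator*≡0 (n ≤? K * ∣ X ∣)
    (∑≡0⇒term≡0 (λ Y → unlinked K X Y f)
      (∑≡0⇒term≡0 (λ X → ∑ (subsets n) (λ Y → unlinked K X Y f)) (m+n≡0⇒m≡0 (bad₁ f) bad≡0) (∈-subsets X))
      (∈-subsets Y)) hX) hY
  sparse : ∀ s (S : Subset n) → R * suc s ≤ n → ∣ S ∣ ≡ suc s → let r = boostAt n s in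
           weight S (boost r S) f < (r ^ 2) ^ suc s
  sparse s S le e = ≰⇒> (indicator≡0 ((r ^ 2) ^ suc s ≤? weight S (boost r S) f)
    (indicator*≡0 (∣ S ∣ ≟ suc s)
      (∑≡0⇒term≡0 (λ S → dense s S f)
        (∑≡0⇒term≡0 (λ s → ∑ (subsets n) (λ S → dense s S f)) (m+n≡0⇒n≡0 (bad₁ f) bad≡0) (∈-downFrom⁺ s<M))
        (∈-subsets S)) e))
    where
    r = boostAt n s
    s<M : s < M
    s<M = ≤-trans (≤-reflexive (sym (m*n/n≡m (suc s) R)))
                  (/-monoˡ-≤ R (≤-trans (≤-reflexive (*-comm (suc s) R)) le))

-- Decisions and sizes of subsets

does-true : ∀ (P? : Dec P) → does P? ≡ true → P
does-true (yes p) _ = p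

x∉p-x : ∀ (p : Subset n) x → x ∉ p - x
x∉p-x (s ∷ p) zero    ()
x∉p-x (s ∷ p) (suc x) (there x∈) = x∉p-x p x x∈

∣p∣≤1+∣p-x∣ : ∀ (p : Subset n) x → ∣ p ∣ ≤ suc ∣ p - x ∣
∣p∣≤1+∣p-x∣ (true  ∷ p) zero    = s≤s (≤-reflexive (cong ∣_∣ (sym (p─⊥≡p p))))
∣p∣≤1+∣p-x∣ (false ∷ p) zero    = m≤n⇒m≤1+n (≤-reflexive (cong ∣_∣ (sym (p─⊥≡p p))))
∣p∣≤1+∣p-x∣ (true  ∷ p) (suc x) = s≤s (∣p∣≤1+∣p-x∣ p x)
∣p∣≤1+∣p-x∣ (false ∷ p) (suc x) = ∣p∣≤1+∣p-x∣ p x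

∣p∣>0⇒nonempty : ∀ (p : Subset n) → 0 < ∣ p ∣ → Nonempty p
∣p∣>0⇒nonempty (true  ∷ p) _ = zero , here
∣p∣>0⇒nonempty (false ∷ p) h with ∣p∣>0⇒nonempty p h
... | x , x∈ = suc x , there x∈

x∉p⇒∣p∣<∣p∪⁅x⁆∣ : ∀ {p : Subset n} {x} → x ∉ p → ∣ p ∣ < ∣ p ∪ ⁅ x ⁆ ∣
x∉p⇒∣p∣<∣p∪⁅x⁆∣ {p = p} {x} x∉p = p⊂q⇒∣p∣<∣q∣ (p⊆p∪q ⁅ x ⁆ , x , q⊆p∪q p ⁅ x ⁆ (x∈⁅x⁆ x) , x∉p)

-- Acyclic sets

successor-in-cycle : ∀ {D : Digraph n} {A} (C : CycleIn D A) → let open CycleIn C using (f) in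
                     ∀ i → ∃ λ i′ → Arc D (f i) (f i′)
successor-in-cycle C i with view i
... | ‵fromℕ     = zero , CycleIn.closing C
... | ‵inject₁ j = suc j , CycleIn.arcs C j

CycleIn-map : ∀ {D : Digraph n} {A A′ : Fin n → Set} (C : CycleIn D A) → (∀ i → A′ (CycleIn.f C i)) → CycleIn D A′
CycleIn-map C h = record { CycleIn C hiding (inA) ; inA = h }

module _ (D : Digraph n) (B : Subset n) (next : Fin n → Fin n)
         (next∈ : ∀ u → u ∈ B → next u ∈ B) (next-arc : ∀ u → u ∈ B → Arc D u (next u)) where

  iter : ℕ → Fin n → Fin n
  iter zero    b = b
  iter (suc i) b = next (iter i b)

  iter-+ : ∀ i j b → iter i (iter j b) ≡ iter (i + j) b
  iter-+ zero    j b = refl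
  iter-+ (suc i) j b = cong next (iter-+ i j b)

  iter∈ : ∀ i {b} → b ∈ B → iter i b ∈ B
  iter∈ zero    b∈ = b∈
  iter∈ (suc i) b∈ = next∈ _ (iter∈ i b∈)

  iter-shift : ∀ {i j} b → i ≤ j → iter i b ≡ iter j b → iter (j ∸ i) (iter i b) ≡ iter i b
  iter-shift {i} {j} b i≤j e = trans (iter-+ (j ∸ i) i b) (trans (cong (λ z → iter z b) (m∸n+n≡m i≤j)) (sym e))

  -- A closed walk that repeats a vertex contains a shorter closed walk.
  closed-walk⇒cycle : ∀ bound ℓ b → ℓ ≤ bound → 0 < ℓ → b ∈ B → iter ℓ b ≡ b → CycleIn D (_∈ B)
  closed-walk⇒cycle zero    zero b _ () b∈ e
  -- A closed walk of length one would be a loop; cycles have at least two vertices.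
  closed-walk⇒cycle (suc bound) (suc zero) b _ _ b∈ e =
    contradiction (trans (sym (loopless D b)) (subst (Arc D b) e (next-arc b b∈))) λ ()
  closed-walk⇒cycle (suc bound) ℓ@(suc (suc m)) b (s≤s ℓ≤) _ b∈ e
    with any? (λ (i : Fin ℓ) → any? (λ (j : Fin ℓ) → (i <? j) ×-dec (iter (toℕ i) b ≟ᶠ iter (toℕ j) b)))
  ... | yes (i , j , i<j , eq) =
    closed-walk⇒cycle bound (toℕ j ∸ toℕ i) (iter (toℕ i) b)
      (≤-trans (m∸n≤m (toℕ j) (toℕ i)) (≤-trans (≤-pred (toℕ<n j)) ℓ≤)) (m<n⇒0<n∸m i<j)
      (iter∈ (toℕ i) b∈) (iter-shift b (<⇒≤ i<j) eq)
  ... | no distinct = record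
    { m       = m
    ; f       = λ i → iter (toℕ i) b
    ; f-inj   = injective
    ; inA     = λ i → iter∈ (toℕ i) b∈
    ; arcs    = λ i → subst (λ z → Arc D (iter z b) (iter (suc (toℕ i)) b)) (sym (toℕ-inject₁ i))
                            (next-arc _ (iter∈ (toℕ i) b∈))
    ; closing = subst₂ (Arc D) (cong (λ z → iter z b) (sym (toℕ-fromℕ (suc m)))) e
                       (next-arc _ (iter∈ (suc m) b∈))
    }
    where
    injective : ∀ {i j : Fin ℓ} → iter (toℕ i) b ≡ iter (toℕ j) b → i ≡ j
    injective {i} {j} eq with <-cmp i j
    ... | tri< i<j _ _ = contradiction (i , j , i<j , eq) distinct
    ... | tri≈ _ i≡j _ = i≡j
    ... | tri> _ _ j<i = contradiction (j , i , j<i , sym eq) distinct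

  -- Among the first `n + 1` iterates two coincide, and the stretch between them is a closed walk.
  successors⇒cycle : Nonempty B → CycleIn D (_∈ B)
  successors⇒cycle (b , b∈) with pigeonhole (n<1+n n) (λ i → iter (toℕ i) b)
  ... | i , j , i<j , eq = closed-walk⇒cycle _ (toℕ j ∸ toℕ i) (iter (toℕ i) b) ≤-refl (m<n⇒0<n∸m i<j)
                             (iter∈ (toℕ i) b∈) (iter-shift b (<⇒≤ i<j) eq)

Arc? : ∀ (D : Digraph n) u v → Dec (Arc D u v)
Arc? D u v = adj D u v ≟ᵇ true

-- Otherwise every vertex of `B` has an out-neighbour in `B`, and following these leads to a cycle.
acyclic⇒sink : ∀ (D : Digraph n) (B : Subset n) → Nonempty B → Acyclic D (_∈ B) →
               ∃ λ u → u ∈ B × (∀ v → v ∈ B → ¬ Arc D u v)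
acyclic⇒sink {n} D B B≠∅ acyclic
  with any? (λ u → (u ∈? B) ×-dec ¬? (any? (λ v → (v ∈? B) ×-dec Arc? D u v)))
... | yes (u , u∈ , none) = u , u∈ , λ v v∈ a → none (v , v∈ , a)
... | no noSink = contradiction (successors⇒cycle D B next next∈ next-arc B≠∅) acyclic
  where
  succ? : ∀ u → Dec (∃ λ v → v ∈ B × Arc D u v)
  succ? u = any? (λ v → (v ∈? B) ×-dec Arc? D u v)
  next : Fin n → Fin n
  next u with succ? u
  ... | yes (v , _) = v
  -- The default `u` keeps `B` closed under `next`.
  ... | no _        = u
  next∈ : ∀ u → u ∈ B → next u ∈ B
  next∈ u u∈ with succ? u
  ... | yes (_ , v∈ , _) = v∈
  ... | no _             = u∈
  next-arc : ∀ u → u ∈ B → Arc D u (next u)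
  next-arc u u∈ with succ? u
  ... | yes (_ , _ , a) = a
  ... | no none         = contradiction (u , u∈ , none) noSink

-- `X` collects `t` sinks removed one after the other and `Y` is what remains; a sink has no arc to
-- any vertex that outlasts it. The inequality `u ≢ v` is recorded because a vertex may choose
-- itself, which gives no arc.
acyclic⇒no-arc-pair : ∀ (D : Digraph n) t (B : Subset n) → t ≤ ∣ B ∣ → Acyclic D (_∈ B) →
  ∃ λ X → ∃ λ Y → t ≤ ∣ X ∣ × ∣ B ∣ ≤ t + ∣ Y ∣ × X ⊆ B × Y ⊆ B
    × (∀ u v → u ∈ X → v ∈ Y → u ≢ v × ¬ Arc D u v)
acyclic⇒no-arc-pair D zero B _ acyclic =
  ⊥ , B , z≤n , ≤-refl , (λ u∈ → contradiction u∈ ∉⊥) , id , λ u v u∈ → contradiction u∈ ∉⊥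
acyclic⇒no-arc-pair {n} D (suc t) B t<∣B∣ acyclic
  with acyclic⇒sink D B (∣p∣>0⇒nonempty B (≤-trans (s≤s z≤n) t<∣B∣)) acyclic
... | u , u∈ , sink
  with acyclic⇒no-arc-pair D t (B - u) (≤-pred (≤-trans t<∣B∣ (∣p∣≤1+∣p-x∣ B u)))
         (λ C → acyclic (CycleIn-map C (λ i → p─q⊆p B ⁅ u ⁆ (CycleIn.inA C i))))
... | X , Y , t≤ , B≤ , X⊆ , Y⊆ , sep =
  X ∪ ⁅ u ⁆ , Y , <-≤-trans (s≤s t≤) (x∉p⇒∣p∣<∣p∪⁅x⁆∣ (λ u∈X → x∉p-x B u (X⊆ u∈X)))
  , ≤-trans (∣p∣≤1+∣p-x∣ B u) (s≤s B≤) , X∪u⊆ , (λ v∈ → p─q⊆p B ⁅ u ⁆ (Y⊆ v∈)) , sep′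
  where
  X∪u⊆ : X ∪ ⁅ u ⁆ ⊆ B
  X∪u⊆ v∈ with x∈p∪q⁻ X ⁅ u ⁆ v∈
  ... | inj₁ v∈X = p─q⊆p B ⁅ u ⁆ (X⊆ v∈X)
  ... | inj₂ v∈u = subst (_∈ B) (sym (x∈⁅y⁆⇒x≡y u v∈u)) u∈
  sep′ : ∀ x y → x ∈ X ∪ ⁅ u ⁆ → y ∈ Y → x ≢ y × ¬ Arc D x y
  sep′ x y x∈ y∈ with x∈p∪q⁻ X ⁅ u ⁆ x∈
  ... | inj₁ x∈X = sep x y x∈X y∈
  ... | inj₂ x∈u with refl ← x∈⁅y⁆⇒x≡y u x∈u =
    (λ { refl → x∉p-x B u (Y⊆ y∈) }) , sink y (p─q⊆p B ⁅ u ⁆ (Y⊆ y∈))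

-- Greedy 2-colouring

opposite : Fin 2 → Fin 2
opposite zero    = suc zero
opposite (suc _) = zero

opposite≢ : ∀ i → opposite i ≢ i
opposite≢ zero       ()
opposite≢ (suc zero) ()

-- When `u` has no out-neighbour in `T`, any `w` will do, so both cases share one form.
AtMostOneOut : Digraph n → Subset n → Fin n → Set
AtMostOneOut D T u = ∃ λ w → ∀ v → v ∈ T → Arc D u v → v ≡ w

-- u is coloured differently from its only out-neighbour in S, so no
-- monochromatic cycle passes through u.
two-colourable : ∀ (D : Digraph n) bound S → ∣ S ∣ ≤ bound →
  (∀ T → T ⊆ S → Nonempty T → ∃ λ u → u ∈ T × AtMostOneOut D T u) → ChromaticAtMost D S 2
two-colourable {n} D bound S ∣S∣≤ light with nonempty? S
... | no S≡∅ = (λ _ → zero) , λ j C → S≡∅ (_ , proj₁ (CycleIn.inA C zero))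
... | yes S≠∅ with light S id S≠∅
two-colourable {n} D zero S ∣S∣≤ light | yes S≠∅ | u , u∈ , _ =
  contradiction (≤-trans (x∈p⇒∣p-x∣<∣p∣ u∈) ∣S∣≤) λ ()
two-colourable {n} D (suc bound) S ∣S∣≤ light | yes S≠∅ | u , u∈ , w , only
  with two-colourable D bound (S - u) (≤-pred (≤-trans (x∈p⇒∣p-x∣<∣p∣ u∈) ∣S∣≤))
         (λ T T⊆ → light T (λ x∈ → p─q⊆p S ⁅ u ⁆ (T⊆ x∈)))
... | c , acyclic = c′ , acyclic′
  where
  c′ : Fin n → Fin 2
  c′ v with v ≟ᶠ u
  -- `w` may lie outside `S - u`; as `c` is total, its colour is still defined.
  ... | yes _ = opposite (c w)
  ... | no _  = c v
  c′-u : c′ u ≡ opposite (c w)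
  c′-u with u ≟ᶠ u
  ... | yes _  = refl
  ... | no u≢u = contradiction refl u≢u
  c′-other : ∀ {v} → v ≢ u → c′ v ≡ c v
  c′-other {v} v≢u with v ≟ᶠ u
  ... | yes v≡u = contradiction v≡u v≢u
  ... | no _    = refl
  acyclic′ : ∀ j → Acyclic D (λ v → v ∈ S × c′ v ≡ j)
  acyclic′ j C with any? (λ i → CycleIn.f C i ≟ᶠ u)
  ... | no avoids = acyclic j (CycleIn-map C (λ i → let v∈ , e = CycleIn.inA C i in
          x∈p∧x≢y⇒x∈p-y v∈ (λ e → avoids (i , e)) , trans (sym (c′-other (λ e → avoids (i , e)))) e))
  ... | yes (i , fi≡u) with successor-in-cycle C i
  ... | i′ , arc = opposite≢ (c w) (begin
    opposite (c w)       ≡⟨ c′-u ⟨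
    c′ u                 ≡⟨ cong c′ fi≡u ⟨
    c′ (f i)             ≡⟨ trans (proj₂ (inA i)) (sym (proj₂ (inA i′))) ⟩
    c′ (f i′)            ≡⟨ c′-other f′≢u ⟩
    c (f i′)             ≡⟨ cong c (only (f i′) (proj₁ (inA i′)) arc′) ⟩
    c w                  ∎)
    where
    open ≡-Reasoning
    open CycleIn C using (f; inA)
    arc′ : Arc D u (f i′)
    arc′ = subst (λ z → Arc D z (f i′)) fi≡u arc
    f′≢u : f i′ ≢ u
    f′≢u e = contradiction (trans (sym (loopless D u)) (subst (Arc D u) e arc′)) λ ()

-- The digraph of a choice of out-neighbours

module _ (f : Choice n d) where

  chosen? : ∀ u v → Dec (u ≢ v × ∃ λ j → lookup (lookup f u) j ≡ v)
  chosen? u v = ¬? (u ≟ᶠ v) ×-dec any? (λ j → lookup (lookup f u) j ≟ᶠ v)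

  choiceDigraph : Digraph n
  choiceDigraph = record
    { adj      = λ u v → does (chosen? u v)
    ; loopless = λ v → dec-false (chosen? v v) (λ h → proj₁ h refl)
    }

weight≡0⇒chosen : ∀ (X Y : Subset n) (f : Choice n d) → weight X (avoid Y) f ≡ 0 →
                  ∃ λ u → u ∈ X × ∃ λ j → lookup (lookup f u) j ∈ Y
weight≡0⇒chosen X Y f e with ∏≡0⇒∃zero _ e
... | u , eu with lookup X u in u∈
... | true with ∏≡0⇒∃zero _ eu
... | j , ej with lookup Y (lookup (lookup f u) j) in j∈
... | true = u , lookup⇒[]= u X u∈ , j , lookup⇒[]= _ Y j∈

boost>0 : ∀ r .{{_ : NonZero r}} (S : Subset n) v → 1 ≤ boost r S v
boost>0 r S v with lookup S v
... | true  = >-nonZero⁻¹ r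
... | false = ≤-refl

-- All factors are at least 1 and an entry in `S` has factor `r`, so a single hit forces weight at
-- least `r`.
rowWeight<r⇒none : ∀ r .{{_ : NonZero r}} (S : Subset n) (row : Vec (Fin n) d) → rowWeight (boost r S) row < r →
                   ∀ j → lookup row j ∉ S
rowWeight<r⇒none {d = suc d} r S (x ∷ row) lt zero x∈ rewrite []=⇒lookup x∈ =
  contradiction lt (≤⇒≯ (begin
    r                                ≡⟨ *-identityʳ r ⟨
    r * 1
      ≤⟨ *-monoʳ-≤ r (≤-trans (≤-reflexive (sym (trans (∏-const d 1) (^-zeroˡ d))))
                            (∏-mono-≤ (λ j → boost>0 r S (lookup row j)))) ⟩
    r * rowWeight (boost r S) row    ∎))
  where open ≤-Reasoning
rowWeight<r⇒none r S (x ∷ row) lt (suc j) =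
  rowWeight<r⇒none r S row (≤-<-trans (≤-trans (≤-reflexive (sym (*-identityˡ _))) (*-monoˡ-≤ _ (boost>0 r S x))) lt) j

-- The first entry in `S` takes one factor `r`, which leaves less than `r` for the rest and so no
-- further hit. The given `w` is the witness for a row that misses `S`.
rowWeight<r²⇒single : ∀ r .{{_ : NonZero r}} (S : Subset n) (w : Fin n) (row : Vec (Fin n) d) →
  rowWeight (boost r S) row < r ^ 2 → ∃ λ w → ∀ j → lookup row j ∈ S → lookup row j ≡ w
rowWeight<r²⇒single r S w [] lt = w , λ ()
rowWeight<r²⇒single r S w (x ∷ row) lt with lookup S x in x∈
... | false with rowWeight<r²⇒single r S w row (≤-<-trans (≤-reflexive (sym (*-identityˡ _))) lt)
... | w′ , single = w′ , λ
  { zero    h → contradiction (trans (sym x∈) ([]=⇒lookup h)) λ ()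
  ; (suc j) h → single j h }
rowWeight<r²⇒single r S w (x ∷ row) lt | true = x , λ
  { zero    h → refl
  ; (suc j) h → contradiction h (rowWeight<r⇒none r S row
      (*-cancelˡ-< r _ _ (<-≤-trans lt (≤-reflexive (cong (r *_) (*-identityʳ r))))) j) }

-- If every row of `S` had weight at least `r ^ 2`, their product would reach the excluded bound.
light-vertex : ∀ r (S : Subset n) (f : Choice n d) → weight S (boost r S) f < (r ^ 2) ^ ∣ S ∣ →
               ∃ λ u → u ∈ S × AtMostOneOut (choiceDigraph f) S u
light-vertex r S f lt with any? (λ u → (u ∈? S) ×-dec (suc (rowWeight (boost r S) (lookup f u)) ≤? r ^ 2))
-- For `r = 0` a row would need weight below 0; hence `r` is nonzero in the next clause.
light-vertex zero S f lt | yes (u , u∈ , ())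
light-vertex r@(suc _) S f lt | yes (u , u∈ , light) with rowWeight<r²⇒single r S u (lookup f u) light
... | w , single = u , u∈ , w , λ v v∈ arc → only v v∈ (does-true (chosen? f u v) arc)
  where
  only : ∀ v → v ∈ S → u ≢ v × (∃ λ j → lookup (lookup f u) j ≡ v) → v ≡ w
  only v v∈ (_ , j , refl) = single j v∈
light-vertex r S f lt | no heavy = contradiction lt (≤⇒≯ (begin
  (r ^ 2) ^ ∣ S ∣                               ≡⟨ ∏-if-1 S (r ^ 2) ⟨
  ∏ (λ u → if lookup S u then r ^ 2 else 1)     ≤⟨ ∏-mono-≤ pointwise ⟩
  weight S (boost r S) f                        ∎))
  where
  open ≤-Reasoning
  pointwise : ∀ u → (if lookup S u then r ^ 2 else 1) ≤ (if lookup S u then rowWeight (boost r S) (lookup f u) else 1)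
  pointwise u with lookup S u in u∈
  ... | true  = ≮⇒≥ (λ light → heavy (u , lookup⇒[]= u S u∈ , light))
  ... | false = ≤-refl

-- Colour classes

colourClass : ∀ {k} → (Fin n → Fin k) → Fin k → Subset n
colourClass c j = tabulate (λ v → does (c v ≟ᶠ j))

∈-colourClass⁻ : ∀ {k} (c : Fin n → Fin k) j {v} → v ∈ colourClass c j → c v ≡ j
∈-colourClass⁻ c j {v} v∈ = does-true (c v ≟ᶠ j) (trans (sym (lookup∘tabulate _ v)) ([]=⇒lookup v∈))

∣S∣≡∑ : ∀ (S : Subset n) → ∣ S ∣ ≡ ∑ (allFin n) (λ v → if lookup S v then 1 else 0)
∣S∣≡∑ {n} S = begin
  ∣ S ∣                    ≡⟨ trans (+-identityʳ _) (*-identityʳ ∣ S ∣) ⟨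
  ∣ S ∣ * 1 + 0            ≡⟨ cong (∣ S ∣ * 1 +_) (*-zeroʳ n) ⟨
  ∣ S ∣ * 1 + n * 0        ≡⟨ ∑-if S 1 0 ⟨
  σ + ∣ S ∣ * 0            ≡⟨ cong (σ +_) (*-zeroʳ ∣ S ∣) ⟩
  σ + 0                    ≡⟨ +-identityʳ σ ⟩
  σ                        ∎
  where
  open ≡-Reasoning
  σ = ∑ (allFin n) (λ v → if lookup S v then 1 else 0)

-- Double counting of incidences between vertices and classes: each vertex lies in the class of its
-- own colour.
n≤∑∣colourClass∣ : ∀ {k} (c : Fin n → Fin k) → n ≤ ∑ (allFin k) (λ j → ∣ colourClass c j ∣)
n≤∑∣colourClass∣ {n} {k} c = begin
  n                                                                            ≡⟨ length-allFin n ⟨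
  length (allFin n)                                                            ≡⟨ ∑-1 (allFin n) ⟨
  ∑ (allFin n) (λ _ → 1)                                                       ≤⟨ ∑-mono-≤ (allFin n) (λ v →
      ≤-trans (≤-reflexive (sym (own v))) (term≤∑ (member v) (∈-allFin (c v)))) ⟩
  ∑ (allFin n) (λ v → ∑ (allFin k) (member v))                                 ≡⟨ ∑-swap (allFin n) (allFin k) member ⟩
  ∑ (allFin k) (λ j → ∑ (allFin n) (λ v → member v j))
    ≡⟨ ∑-cong (allFin k) (λ j → ∣S∣≡∑ (colourClass c j)) ⟨
  ∑ (allFin k) (λ j → ∣ colourClass c j ∣)                                     ∎
  where
  open ≤-Reasoning
  member : Fin n → Fin k → ℕ
  member v j = if lookup (colourClass c j) v then 1 else 0
  own : ∀ v → member v (c v) ≡ 1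
  own v = cong (λ b → if b then 1 else 0) (trans (lookup∘tabulate _ v) (dec-true (c v ≟ᶠ c v) refl))

-- Otherwise each class misses the bound by at least 1, and summing over the `k` colours gives
-- `k * n + k ≤ k * n`.
large-colourClass : ∀ {k} .{{_ : NonZero k}} (c : Fin n → Fin k) → ∃ λ j → n ≤ k * ∣ colourClass c j ∣
large-colourClass {n} {k} c with any? (λ j → n ≤? k * ∣ colourClass c j ∣)
... | yes found = found
... | no none   = contradiction (begin-strict
  k * n                                                        <⟨ m<m+n (k * n) (>-nonZero⁻¹ k) ⟩
  k * n + k                                                    ≤⟨ +-monoˡ-≤ k (*-monoʳ-≤ k (n≤∑∣colourClass∣ c)) ⟩
  k * ∑ (allFin k) size + k
    ≡⟨ cong₂ _+_ (∑-*ˡ (allFin k) size k) (sym (trans (∑-1 (allFin k)) (length-allFin k))) ⟩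
  ∑ (allFin k) (λ j → k * size j) + ∑ (allFin k) (λ _ → 1)     ≡⟨ ∑-distrib-+ (allFin k) _ _ ⟨
  ∑ (allFin k) (λ j → k * size j + 1)
    ≤⟨ ∑-mono-≤ (allFin k) (λ j → ≤-trans (≤-reflexive (+-comm _ 1)) (≰⇒> (λ le → none (j , le)))) ⟩
  ∑ (allFin k) (λ _ → n)
    ≡⟨ trans (∑-const (allFin k) n) (cong (_* n) (length-allFin k)) ⟩
  k * n                                                        ∎) (<-irrefl refl)
  where
  open ≤-Reasoning
  size : Fin k → ℕ
  size j = ∣ colourClass c j ∣

-- A class of size at least `n / k` yields `X` and `Y` of at least a third of its size, hence at
-- least `n / (3 * k)`. A `Good` choice links them, against the absence of arcs from `X` to `Y`.
not-k-colourable : ∀ {k} .{{_ : NonZero k}} → k < n → (f : Choice n d) → Good (3 * k) f →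
                   ¬ ChromaticAtMost (choiceDigraph f) ⊤ k
not-k-colourable {n} {k = k} k<n f good (c , acyclic) with large-colourClass c
... | j , n≤ka with acyclic⇒no-arc-pair (choiceDigraph f) ⌊ ∣ colourClass c j ∣ /2⌋ (colourClass c j) (⌊n/2⌋≤n _)
                      (λ C → acyclic j (CycleIn-map C (λ i → ∈⊤ , ∈-colourClass⁻ c j (CycleIn.inA C i))))
... | X , Y , t≤X , a≤t+Y , _ , _ , sep with weight≡0⇒chosen X Y f (Good.linked good X Y (n≤3k* t≤X) (n≤3k* t≤Y))
  where
  a = ∣ colourClass c j ∣
  t = ⌊ a /2⌋
  -- This is where `k < n` enters: the half of a one-vertex class would be empty.
  1<a : 1 < a
  1<a = *-cancelˡ-< k 1 a (<-≤-trans (≤-<-trans (≤-reflexive (*-identityʳ k)) k<n) n≤ka)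
  -- Halving with rounding down keeps at least a third, and exactly a third at `a = 3`.
  a≤3t : ∀ a → 1 < a → a ≤ 3 * ⌊ a /2⌋
  a≤3t (suc zero) (s≤s ())
  a≤3t (suc (suc zero)) _ = s≤s (s≤s z≤n)
  a≤3t (suc (suc (suc zero))) _ = ≤-refl
  a≤3t (suc (suc a@(suc (suc _)))) _ = begin
    2 + a                  ≤⟨ +-monoʳ-≤ 2 (a≤3t a (s≤s (s≤s z≤n))) ⟩
    2 + 3 * ⌊ a /2⌋        ≤⟨ n≤1+n _ ⟩
    3 + 3 * ⌊ a /2⌋        ≡⟨ *-suc 3 ⌊ a /2⌋ ⟨
    3 * suc ⌊ a /2⌋        ∎
    where open ≤-Reasoning
  n≤3k* : ∀ {x} → t ≤ x → n ≤ 3 * k * x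
  n≤3k* {x} t≤x = begin
    n                ≤⟨ n≤ka ⟩
    k * a            ≤⟨ *-monoʳ-≤ k (≤-trans (a≤3t a 1<a) (*-monoʳ-≤ 3 t≤x)) ⟩
    k * (3 * x)      ≡⟨ rot k x ⟩
    3 * k * x        ∎
    where
    open ≤-Reasoning
    rot : ∀ k x → k * (3 * x) ≡ 3 * k * x
    rot = solve-∀
  t≤Y : t ≤ ∣ Y ∣
  t≤Y = +-cancelˡ-≤ t _ _ (≤-trans (≤-trans (+-monoʳ-≤ t (⌊n/2⌋≤⌈n/2⌉ a)) (≤-reflexive (⌊n/2⌋+⌈n/2⌉≡n a))) a≤t+Y)
... | u , u∈ , i , v∈ = let u≢v , ¬arc = sep u _ u∈ v∈ in
  ¬arc (dec-true (chosen? f u _) (u≢v , i , refl))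

-- The size bound passes from `S` to its subsets, so `sparse` and `light-vertex` supply the vertex
-- needed at each stage of the greedy colouring.
small⇒2-colourable : ∀ {K} (f : Choice n d) → Good K f → ∀ S → 64 * 2 ^ d * ∣ S ∣ ≤ n → ChromaticAtMost (choiceDigraph f) S 2
small⇒2-colourable {n} {d} f good S small = two-colourable (choiceDigraph f) ∣ S ∣ S ≤-refl light
  where
  light : ∀ T → T ⊆ S → Nonempty T → ∃ λ u → u ∈ T × AtMostOneOut (choiceDigraph f) T u
  light T T⊆S (x , x∈) with ∣ T ∣ in e
  ... | zero  = contradiction (subst (1 ≤_) e (≤-trans (s≤s z≤n) (x∈p⇒∣p-x∣<∣p∣ x∈))) λ ()
  ... | suc s = light-vertex (boostAt n s) T f
    (subst (λ z → weight T (boost (boostAt n s) T) f < (boostAt n s ^ 2) ^ z) (sym e)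
      (Good.sparse good s T (≤-trans (*-monoʳ-≤ (64 * 2 ^ d) (≤-trans (≤-reflexive (sym e)) (p⊆q⇒∣p∣≤∣q∣ T⊆S))) small) e))

-- Clearing the rational bound and choice of constants

≤-fraction : ∀ R s m → toℚ s ℚ.≤ (ℤ.+ 1 ℚ./ suc R) ℚ.* toℚ m → suc R * s ≤ m
≤-fraction R s m le = ≤-trans (≤-reflexive (lhs R s)) (≤-trans (ℤ.drop‿+≤+ cleared) (≤-reflexive (rhs m)))
  where
  -- Products in `ℚ` are normalised; moving to unnormalised rationals allows cross-multiplication.
  integral : mkℚᵘ (ℤ.+ s) 0 ℚᵘ.≤ mkℚᵘ (ℤ.+ 1) R ℚᵘ.* mkℚᵘ (ℤ.+ m) 0
  integral = ℚᵘ.≤-respˡ-≃ (ℚ.toℚᵘ-fromℚᵘ (mkℚᵘ (ℤ.+ s) 0))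
    (ℚᵘ.≤-respʳ-≃ (ℚᵘ.≃-trans (ℚ.toℚᵘ-homo-* (ℤ.+ 1 ℚ./ suc R) (toℚ m))
       (ℚᵘ.*-cong (ℚ.toℚᵘ-fromℚᵘ (mkℚᵘ (ℤ.+ 1) R)) (ℚ.toℚᵘ-fromℚᵘ (mkℚᵘ (ℤ.+ m) 0))))
      (ℚ.toℚᵘ-mono-≤ le))
  cleared : ℤ.+ (s * (suc R * 1)) ℤ.≤ ℤ.+ (1 * m * 1)
  cleared = subst₂ ℤ._≤_ (sym (ℤ.pos-* s (suc R * 1)))
    (trans (cong (ℤ._* ℤ.+ 1) (sym (ℤ.pos-* 1 m))) (sym (ℤ.pos-* (1 * m) 1))) (ℚᵘ.drop-*≤* integral)
  lhs : ∀ R s → (1 + R) * s ≡ s * ((1 + R) * 1)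
  lhs = solve-∀
  rhs : ∀ m → 1 * m * 1 ≡ m
  rhs = solve-∀

theorem3 : ∀ (k : ℕ) → k ≥ 1 →
    Σ ℚ λ ε → Positive ε × (Σ ℕ λ N → ∀ (n : ℕ) → n ≥ N →
    Σ (Digraph n) λ D →
    (¬ ChromaticAtMost D ⊤ k)
    × (∀ (S : Subset n) → toℚ ∣ S ∣ ℚ.≤ ε ℚ.* toℚ n → ChromaticAtMost D S 2))
-- The denominator `suc R` is visibly nonzero, and the surplus `∣ S ∣` it brings is dropped by
-- `m≤n+m`. The threshold `suc k` gives `k < n`, which also excludes `n = 0`.
theorem3 k@(suc _) k≥1 = ℤ.+ 1 ℚ./ suc R , ℚ.normalize-pos 1 (suc R) , suc k , λ
  { zero ()
  ; n@(suc _) k<n → let f , good = ∃-good n K in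
      choiceDigraph f , not-k-colourable k<n f good ,
      λ S le → small⇒2-colourable f good S (≤-trans (m≤n+m _ ∣ S ∣) (≤-fraction R ∣ S ∣ n le)) }
  where
  -- Both halves of a large colour class have size at least `n / K`; the exponent in `R` is the
  -- number of draws per vertex.
  K = 3 * k
  R = 64 * 2 ^ (K * (3 * K))
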